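{- For all integers $n\ge 0$, \[ E_n(t,q) = \frac{1}{(1-q)^{2n}} \sum_{k=0}^n \left( \binom{2n}{n-k} - \binom{2n}{n-k-1} \right) t^k q^{k(k+1)}\, T_k(t^{ -1}, q^{ -1}),\] where $\{T_k(t,q)\}_{k\ge0}$ is the family of polynomials in $t$ and $q$ determined uniquely by $T_0(t,q)=1$ and, for $k\geq1$, \[ T_k(t,q) = T_{k-1}(t,q) + (1+t)(-q)^{k^2} + (1-t^2) \sum_{i=1}^{k-1} (-q)^{k^2-i^2}\, T_{i-1}(t,q). \]
   Context: Here $t,q$ are indeterminates, $[n]_q=(1-q^n)/(1-q)$ and $[n]_{t,q}=(1-tq^n)/(1-q)$. The $(t,q)$-Euler numbers $E_n(t,q)$, $n\ge 0$, are defined by the continued fraction expansion (as a formal power series in $x$) \[ \sum_{n\geq0} E_{n}(t,q) x^n = \cfrac{1}{1- \cfrac{[1]_q[1]_{t,q}\, x}{1- \cfrac{[2]_q[2]_{t,q}\, x}{1-\cdots}}}, \] where the $m$-th partial coefficient is $[m]_q[m]_{t,q}$. Binomial coefficients $\binom{a}{b}$ with $b<0$ are $0$. -}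

module Defs where

open import Algebra.Bundles using (CommutativeRing)
import Algebra.Properties.Monoid.Mult as MonoidMult
import Algebra.Properties.Ring as RingProperties
import Algebra.Properties.Semiring.Exp as SemiringExp
import Algebra.Properties.Semiring.Sum as SemiringSum
open import Data.Fin.Base using (Fin; suc; toℕ)
open import Data.Integer.Base using (ℤ; +_; -[1+_])
open import Data.Nat.Base as ℕ using (ℕ; zero; suc; _∸_; z≤n; s≤s)
open import Data.Nat.Combinatorics using (_C_)
import Data.Nat.Properties as ℕ
import Relation.Binary.PropositionalEquality as ≡
import Relation.Binary.Reasoning.Setoid as SetoidReasoning

-- The lower index is an integer because n - k - 1 is negative for k = n;
-- with truncated subtraction the binomial would be 1 there instead of 0.
binom : ℕ → ℤ → ℕ
binom a (+ b)    = a C b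
binom a -[1+ _ ] = 0

-- Indeterminates are rendered as elements t, q of an arbitrary commutative
-- ring in which the needed inverses exist.  The ring ℤ[t^±1, q^±1, (1-q)^-1],
-- a subring of ℚ(t,q), is the initial such ring, so an identity for all
-- (R, t, q) is the same as the identity between rational functions in the
-- indeterminates t, q.
module Over {c ℓ} (R : CommutativeRing c ℓ) where

  open CommutativeRing R public hiding (zero)
  open SemiringExp semiring public using (_^_)
  open MonoidMult +-monoid public using (_×_)
  open SemiringSum semiring public using (sum-syntax; sum⁺-syntax)
  open SemiringSum semiring using (sum-cong-≋)
  open RingProperties ring using (-‿distribˡ-*; -‿+-comm; -0#≈0#)
  open SetoidReasoning setoid

  -- Coefficient sequences of formal power series in x.
  Series : Set c
  Series = ℕ → Carrier

  infixl 7 _⊛_ _·_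

  _⊛_ : Series → Series → Series
  (f ⊛ g) n = ∑[ i ≤ n ] (f (toℕ i) * g (n ∸ toℕ i))

  _·_ : Carrier → Series → Series
  (a · f) n = a * f n

  one : Series
  one zero    = 1#
  one (suc _) = 0#

  1-x_ : Series → Series
  (1-x g) zero    = 1#
  (1-x g) (suc n) = - g n

  -- The reciprocal of 1 - x g, see reciprocal-inverse.  The auxiliary
  -- function is  recSum g n d = Σ_{i=0}^{n} g_{d+i} (1 / (1 - x g))_{n-i}.
  mutual
    1/1-x_ : Series → Series
    (1/1-x g) zero    = 1#
    (1/1-x g) (suc n) = recSum g n 0

    recSum : Series → ℕ → ℕ → Carrier
    recSum g zero    d = g d * (1/1-x g) zero
    recSum g (suc n) d = g d * (1/1-x g) (suc n) + recSum g n (suc d)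

  recSum-sum : ∀ g n d →
    recSum g n d ≈ ∑[ i ≤ n ] (g (d ℕ.+ toℕ i) * (1/1-x g) (n ∸ toℕ i))
  recSum-sum g zero d = begin
    g d * 1#                ≡⟨ ≡.cong (λ e → g e * 1#) (ℕ.+-identityʳ d) ⟨
    g (d ℕ.+ 0) * 1#        ≈⟨ +-identityʳ _ ⟨
    g (d ℕ.+ 0) * 1# + 0#   ∎
  recSum-sum g (suc n) d = +-cong
    (reflexive (≡.cong (λ e → g e * (1/1-x g) (suc n)) (≡.sym (ℕ.+-identityʳ d))))
    (trans (recSum-sum g n (suc d))
           (sum-cong-≋ {suc n} λ i →
             reflexive (≡.cong (λ e → g e * (1/1-x g) (n ∸ toℕ i))
                               (≡.sym (ℕ.+-suc d (toℕ i))))))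

  private
    sum-neg : ∀ n (f : Fin n → Carrier) →
      ∑[ i < n ] (- f i) ≈ - (∑[ i < n ] f i)
    sum-neg zero    f = sym -0#≈0#
    sum-neg (suc n) f =
      trans (+-congˡ (sum-neg n (λ i → f (suc i)))) (-‿+-comm _ _)

  reciprocal-inverse : ∀ g n → ((1-x g) ⊛ (1/1-x g)) n ≈ one n
  reciprocal-inverse g zero = trans (+-identityʳ _) (*-identityˡ 1#)
  reciprocal-inverse g (suc n) = begin
    1# * recSum g n 0 + ∑[ i ≤ n ] (- g (toℕ i) * h (n ∸ toℕ i))
      ≈⟨ +-cong (trans (*-identityˡ _) (recSum-sum g n 0))
                (sum-cong-≋ {suc n} λ i → sym (-‿distribˡ-* (g (toℕ i)) (h (n ∸ toℕ i)))) ⟩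
    ∑[ i ≤ n ] (g (toℕ i) * h (n ∸ toℕ i)) + ∑[ i ≤ n ] (- (g (toℕ i) * h (n ∸ toℕ i)))
      ≈⟨ +-congˡ (sum-neg (suc n) (λ i → g (toℕ i) * h (n ∸ toℕ i))) ⟩
    ∑[ i ≤ n ] (g (toℕ i) * h (n ∸ toℕ i)) - ∑[ i ≤ n ] (g (toℕ i) * h (n ∸ toℕ i))
      ≈⟨ -‿inverseʳ _ ⟩
    0# ∎
    where h = 1/1-x g

  -- convergent a m N = 1 / (1 - a_m x / (1 - a_{m+1} x / ⋯ (1 - a_{m+N-1} x)))
  convergent : (ℕ → Carrier) → ℕ → ℕ → Series
  convergent a m zero    = one
  convergent a m (suc N) = 1/1-x (a m · convergent a (suc m) N)

  -- The infinite continued fraction 1 / (1 - a₁ x / (1 - a₂ x / ⋯)) is the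
  -- x-adic limit of its convergents: the n-th coefficient is the same in all
  -- convergents of depth at least n, see convergent-stable.
  continuedFraction : (ℕ → Carrier) → Series
  continuedFraction a n = convergent a 1 n n

  private
    mutual
      1/1-x-cong : ∀ {g h : Series} n → (∀ {i} → i ℕ.< n → g i ≈ h i) →
        (1/1-x g) n ≈ (1/1-x h) n
      1/1-x-cong zero    eq = refl
      1/1-x-cong (suc n) eq = recSum-cong n 0 (λ i<1+n → eq i<1+n)

      recSum-cong : ∀ {g h : Series} n d →
        (∀ {i} → i ℕ.< suc (d ℕ.+ n) → g i ≈ h i) →
        recSum g n d ≈ recSum h n d
      recSum-cong zero d eq = *-congʳ (eq (s≤s (ℕ.m≤m+n d 0)))
      recSum-cong {g} {h} (suc n) d eq = +-cong
        (*-cong (eq (s≤s (ℕ.m≤m+n d (suc n))))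
                (1/1-x-cong (suc n)
                  λ i<1+n → eq (ℕ.≤-trans i<1+n
                                 (ℕ.≤-trans (ℕ.n≤1+n _) (s≤s (ℕ.m≤n+m (suc n) d))))))
        (recSum-cong n (suc d)
          λ {i} p → eq (≡.subst (λ e → i ℕ.< suc e) (≡.sym (ℕ.+-suc d n)) p))

    convergent-agree : ∀ a m {n N M} → n ℕ.≤ N → n ℕ.≤ M →
      convergent a m N n ≈ convergent a m M n
    convergent-agree a m {N = zero}  {zero}  z≤n z≤n = refl
    convergent-agree a m {N = zero}  {suc M} z≤n z≤n = refl
    convergent-agree a m {N = suc N} {zero}  z≤n z≤n = refl
    convergent-agree a m {n} {suc N} {suc M} n≤N n≤M =
      1/1-x-cong n λ i<n → *-congˡ (convergent-agree a (suc m)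
        (ℕ.≤-pred (ℕ.≤-trans i<n n≤N)) (ℕ.≤-pred (ℕ.≤-trans i<n n≤M)))

  convergent-stable : ∀ a {n N} → n ℕ.≤ N →
    convergent a 1 N n ≈ continuedFraction a n
  convergent-stable a n≤N = convergent-agree a 1 n≤N ℕ.≤-refl

  -- Below, r stands for 1 / (1 - q).

  qInt : (q r : Carrier) → ℕ → Carrier
  qInt q r n = (1# - q ^ n) * r

  tqInt : (t q r : Carrier) → ℕ → Carrier
  tqInt t q r n = (1# - t * q ^ n) * r

  E : (t q r : Carrier) → ℕ → Carrier
  E t q r = continuedFraction (λ m → qInt q r m * tqInt t q r m)

  -- T k t q is the value of the polynomial T_k at (t , q), and
  -- T-sum k j t q = Σ_{i=1}^{j} (-q)^(k² - i²) T_{i-1}(t,q) for j < k.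
  -- The defining recurrence in its usual form is T-recurrence.

  mutual
    T : ℕ → Carrier → Carrier → Carrier
    T zero    t q = 1#
    T (suc k) t q =
      T k t q + (1# + t) * (- q) ^ (suc k ℕ.* suc k)
              + (1# - t * t) * T-sum (suc k) k t q

    T-sum : ℕ → ℕ → Carrier → Carrier → Carrier
    T-sum k zero    t q = 0#
    T-sum k (suc j) t q =
      T-sum k j t q + (- q) ^ (k ℕ.* k ∸ suc j ℕ.* suc j) * T j t q

  private
    sum-last : ∀ (f : ℕ → Carrier) j →
      ∑[ i < suc j ] f (toℕ i) ≈ ∑[ i < j ] f (toℕ i) + f j
    sum-last f zero    = +-comm (f 0) 0#
    sum-last f (suc j) =
      trans (+-congˡ (sum-last (λ i → f (suc i)) j)) (sym (+-assoc _ _ _))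

    T-sum-sum : ∀ k j t q → T-sum k j t q ≈
      ∑[ i < j ] ((- q) ^ (k ℕ.* k ∸ suc (toℕ i) ℕ.* suc (toℕ i)) * T (toℕ i) t q)
    T-sum-sum k zero    t q = refl
    T-sum-sum k (suc j) t q = trans (+-congʳ (T-sum-sum k j t q))
      (sym (sum-last (λ i → (- q) ^ (k ℕ.* k ∸ suc i ℕ.* suc i) * T i t q) j))

  -- The sum over 1 ≤ i ≤ k - 1 for index suc k is indexed here by i - 1.
  T-recurrence : ∀ k t q → T (suc k) t q ≈
    T k t q + (1# + t) * (- q) ^ (suc k ℕ.* suc k)
            + (1# - t * t) *
              ∑[ i < k ] ((- q) ^ (suc k ℕ.* suc k ∸ suc (toℕ i) ℕ.* suc (toℕ i))
                          * T (toℕ i) t q)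
  T-recurrence k t q = +-congˡ (*-congˡ (T-sum-sum (suc k) k t q))

-- Put λ m = (1 - q^m) (1 - t q^m).  The coefficients of the continued fraction
-- with partial coefficients λ m count nonnegative lattice paths, weighted by λ
-- on the down steps.  With x = z / (1 + z)², the expansion coefficients in x
-- of (1 + z)^(m+1) z^k are ballot numbers, and the path series that end at
-- height m become (1 + z)^(m+1) A_m (z), where
--   A_{m-1} = (1 + z) A_m - λ (m+1) z A_{m+1},   A_{-1} = 1.
-- It remains to see that the coefficients of A_0 are t^k q^(k(k+1)) T_k (1/t, 1/q).
-- The key is the q-difference equation
--   q^(2m+2) (t + q z) A_m (q² z)
--     = (1 - q z) (λ (m+1) A_{m+1} - A_m) + q^(m+1) (1 + t) A_m,
-- which holds because the difference of its two sides satisfies a linear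
-- recurrence of the same kind as A and vanishes for m = -1.  For m = 0 it gives
-- a three-term recurrence for the coefficients of A_0, and eliminating the sum
-- from the definition of T_k gives the same recurrence.
module Submission where

open import Defs
open import Algebra.Bundles using (CommutativeRing; RawRing)
import Algebra.Properties.AbelianGroup as AbelianGroupProperties
import Algebra.Properties.CommutativeSemigroup as CommutativeSemigroupProperties
import Algebra.Properties.Monoid.Mult as MonoidMult
import Algebra.Properties.Ring as RingProperties
import Algebra.Properties.Semiring.Exp as SemiringExp
import Algebra.Properties.Semiring.Mult as SemiringMult
import Algebra.Properties.Semiring.Sum as SemiringSum
import Algebra.Solver.Ring as RingSolver
open import Algebra.Solver.Ring.AlmostCommutativeRing
  using (_-Raw-AlmostCommutative⟶_; fromCommutativeRing; Induced-equivalence)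
open import Data.Fin.Base using (toℕ)
open import Data.Fin.Properties using (toℕ≤pred[n])
open import Data.Integer.Base as ℤ using (+_)
import Data.Integer.Properties as ℤ
open import Data.Maybe.Base using (just; nothing)
open import Data.Nat.Base as ℕ using (ℕ; zero; suc; _∸_; s≤s; z≤n)
open import Data.Nat.Combinatorics using (_C_; nCk≡nC[n∸k]; nCk+nC[k+1]≡[n+1]C[k+1])
import Data.Nat.Properties as ℕ
import Data.Nat.Tactic.RingSolver as ℕ
open import Data.Product.Base using (_,_) renaming (_×_ to _∧_)
open import Function.Base using (_∘_)
open import Relation.Binary.Definitions using (WeaklyDecidable)
open import Relation.Binary.PropositionalEquality as ≡ using (_≡_)
import Relation.Binary.Reasoning.Setoid as SetoidReasoning
open import Relation.Nullary.Decidable using (yes; no)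

-- Ring solver with integer coefficients

-- The solver takes its coefficients from ℤ, represented by pairs (a , b)
-- standing for a - b.  The pairs are kept reduced (a = 0 or b = 0), as the
-- solver compares normal forms up to syntactic equality of coefficients.
module IntegerSolver {c ℓ} (R : CommutativeRing c ℓ) where

  open CommutativeRing R
  open MonoidMult +-monoid using (_×_; ×-homo-+; ×-congˡ)
  open SemiringMult semiring using (×1-homo-*)
  open RingProperties ring using (-‿+-comm; x[y-z]≈xy-xz; [y-z]x≈yx-zx; -0#≈0#)
  open AbelianGroupProperties +-abelianGroup using (⁻¹-anti-homo‿-)
  open CommutativeSemigroupProperties +-commutativeSemigroup using (interchange)
  open SetoidReasoning setoid

  value : ℕ ∧ ℕ → Carrier
  value (a , b) = a × 1# - b × 1#

  a-0≈a : ∀ a → a - 0# ≈ a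
  a-0≈a a = trans (+-congˡ -0#≈0#) (+-identityʳ a)

  value-equal : ∀ a b c d → a ℕ.+ d ≡ c ℕ.+ b → value (a , b) ≈ value (c , d)
  value-equal a b c d eq = begin
    A - U               ≈⟨ a-0≈a _ ⟨
    (A - U) - 0#        ≈⟨ +-congˡ (-‿cong (-‿inverseʳ W)) ⟨
    (A - U) - (W - W)   ≈⟨ +-congˡ (⁻¹-anti-homo‿- W W) ⟩
    (A - U) + (W - W)   ≈⟨ interchange _ _ _ _ ⟩
    (A + W) + (- U - W) ≈⟨ +-congʳ (trans (sym (×-homo-+ 1# a d))
                             (trans (×-congˡ eq) (×-homo-+ 1# c b))) ⟩
    (V + U) + (- U - W) ≈⟨ +-congˡ (+-comm _ _) ⟩
    (V + U) + (- W - U) ≈⟨ interchange _ _ _ _ ⟩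
    (V - W) + (U - U)   ≈⟨ +-congˡ (-‿inverseʳ U) ⟩
    (V - W) + 0#        ≈⟨ +-identityʳ _ ⟩
    V - W               ∎
    where
    A = a × 1#
    U = b × 1#
    V = c × 1#
    W = d × 1#

  reduce : ℕ ∧ ℕ → ℕ ∧ ℕ
  reduce (a , b) = (a ∸ b , b ∸ a)

  value-reduce : ∀ x → value (reduce x) ≈ value x
  value-reduce (a , b) = value-equal (a ∸ b) (b ∸ a) a b (max a b)
    where
    max : ∀ a b → a ∸ b ℕ.+ b ≡ a ℕ.+ (b ∸ a)
    max zero    b       = ≡.cong (ℕ._+ b) (ℕ.0∸n≡0 b)
    max (suc a) zero    = ≡.refl
    max (suc a) (suc b) = ≡.trans (ℕ.+-suc (a ∸ b) b) (≡.cong suc (max a b))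

  differences : RawRing _ _
  differences = record
    { Carrier = ℕ ∧ ℕ
    ; _≈_     = _≡_
    ; _+_     = λ (a , b) (c , d) → reduce (a ℕ.+ c , b ℕ.+ d)
    ; _*_     = λ (a , b) (c , d) → reduce (a ℕ.* c ℕ.+ b ℕ.* d , a ℕ.* d ℕ.+ b ℕ.* c)
    ; -_      = λ (a , b) → (b , a)
    ; 0#      = (0 , 0)
    ; 1#      = (1 , 0)
    }

  module D = RawRing differences

  -- Agrees with value, but lets the constants 0 and 1 in solver goals be
  -- literally 0# and 1#.
  ⟦_⟧ : ℕ ∧ ℕ → Carrier
  ⟦ 0 , 0 ⟧ = 0#
  ⟦ 1 , 0 ⟧ = 1#
  ⟦ x ⟧     = value x

  ⟦⟧≈value : ∀ x → ⟦ x ⟧ ≈ value x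
  ⟦⟧≈value (0 , 0)           = sym (a-0≈a 0#)
  ⟦⟧≈value (1 , 0)           = sym (trans (a-0≈a _) (+-identityʳ 1#))
  ⟦⟧≈value (0 , suc b)       = refl
  ⟦⟧≈value (1 , suc b)       = refl
  ⟦⟧≈value (suc (suc a) , b) = refl

  value-+ : ∀ x y → value (x D.+ y) ≈ value x + value y
  value-+ (a , b) (c , d) = begin
    value (reduce (a ℕ.+ c , b ℕ.+ d))        ≈⟨ value-reduce (a ℕ.+ c , b ℕ.+ d) ⟩
    (a ℕ.+ c) × 1# - (b ℕ.+ d) × 1#
      ≈⟨ +-cong (×-homo-+ 1# a c) (-‿cong (×-homo-+ 1# b d)) ⟩
    (a × 1# + c × 1#) - (b × 1# + d × 1#)     ≈⟨ +-congˡ (-‿+-comm _ _) ⟨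
    (a × 1# + c × 1#) + (- (b × 1#) - d × 1#) ≈⟨ interchange _ _ _ _ ⟩
    value (a , b) + value (c , d)             ∎

  value-* : ∀ x y → value (x D.* y) ≈ value x * value y
  value-* (a , b) (c , d) = begin
    value (reduce (a ℕ.* c ℕ.+ b ℕ.* d , a ℕ.* d ℕ.+ b ℕ.* c))
      ≈⟨ value-reduce (a ℕ.* c ℕ.+ b ℕ.* d , a ℕ.* d ℕ.+ b ℕ.* c) ⟩
    (a ℕ.* c ℕ.+ b ℕ.* d) × 1# - (a ℕ.* d ℕ.+ b ℕ.* c) × 1#
      ≈⟨ +-cong (homo a c b d) (-‿cong (homo a d b c)) ⟩
    (A * V + U * W) - (A * W + U * V)     ≈⟨ +-congˡ (-‿+-comm _ _) ⟨
    (A * V + U * W) + (- (A * W) - U * V) ≈⟨ interchange _ _ _ _ ⟩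
    (A * V - A * W) + (U * W - U * V)     ≈⟨ +-congˡ (⁻¹-anti-homo‿- _ _) ⟨
    (A * V - A * W) - (U * V - U * W)
      ≈⟨ +-cong (x[y-z]≈xy-xz A V W) (-‿cong (x[y-z]≈xy-xz U V W)) ⟨
    A * (V - W) - U * (V - W)             ≈⟨ [y-z]x≈yx-zx (V - W) A U ⟨
    (A - U) * (V - W)                     ∎
    where
    A = a × 1#
    U = b × 1#
    V = c × 1#
    W = d × 1#
    homo : ∀ k l m n →
      (k ℕ.* l ℕ.+ m ℕ.* n) × 1# ≈ k × 1# * (l × 1#) + m × 1# * (n × 1#)
    homo k l m n = trans (×-homo-+ 1# (k ℕ.* l) (m ℕ.* n))
                         (+-cong (×1-homo-* k l) (×1-homo-* m n))

  morphism : differences -Raw-AlmostCommutative⟶ fromCommutativeRing R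
  morphism = record
    { ⟦_⟧    = ⟦_⟧
    ; +-homo = λ x y → trans (⟦⟧≈value (x D.+ y)) (trans (value-+ x y)
                         (sym (+-cong (⟦⟧≈value x) (⟦⟧≈value y))))
    ; *-homo = λ x y → trans (⟦⟧≈value (x D.* y)) (trans (value-* x y)
                         (sym (*-cong (⟦⟧≈value x) (⟦⟧≈value y))))
    ; -‿homo = λ (a , b) → trans (⟦⟧≈value (b , a))
                 (sym (trans (-‿cong (⟦⟧≈value (a , b))) (⁻¹-anti-homo‿- _ _)))
    ; 0-homo = refl
    ; 1-homo = refl
    }

  -- Equality is tested between integers. Distinct integers may still coincide in `R`, so the
  -- negative case decides nothing.
  _≟_ : WeaklyDecidable (Induced-equivalence morphism)
  x@(a , b) ≟ y@(c , d) with a ℕ.+ d ℕ.≟ c ℕ.+ b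
  ... | yes eq = just (trans (⟦⟧≈value x)
                         (trans (value-equal a b c d eq) (sym (⟦⟧≈value y))))
  ... | no _   = nothing

  open RingSolver differences (fromCommutativeRing R) morphism _≟_ public
    using (Polynomial; con; solve; _:=_; _:+_; _:*_; _:-_; :-_)

  :1 : ∀ {n} → Polynomial n
  :1 = con (1 , 0)

  :0 : ∀ {n} → Polynomial n
  :0 = con (0 , 0)

-- Cauchy products of coefficient sequences

module Convolution {c ℓ} (R : CommutativeRing c ℓ) where

  open Over R
  open IntegerSolver R
  open SemiringSum semiring using (sum-cong-≋; *-distribˡ-sum; sum-replicate-zero)
  open SetoidReasoning setoid

  ·-⊛ : ∀ a f g n → ((a · f) ⊛ g) n ≈ a * (f ⊛ g) n
  ·-⊛ a f g n = trans (sum-cong-≋ {suc n} λ i → *-assoc a (f (toℕ i)) (g (n ∸ toℕ i)))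
                      (sym (*-distribˡ-sum {suc n} a λ i → f (toℕ i) * g (n ∸ toℕ i)))

  one-⊛ : ∀ f n → (one ⊛ f) n ≈ f n
  one-⊛ f zero    = solve 1 (λ x → :1 :* x :+ :0 := x) refl (f 0)
  one-⊛ f (suc n) = begin
    1# * f (suc n) + ∑[ i ≤ n ] (0# * f (n ∸ toℕ i))
      ≈⟨ +-cong (*-identityˡ _) (sum-cong-≋ {suc n} λ i → zeroˡ (f (n ∸ toℕ i))) ⟩
    f (suc n) + ∑[ i ≤ n ] 0#
      ≈⟨ +-congˡ (sum-replicate-zero (suc n)) ⟩
    f (suc n) + 0#
      ≈⟨ +-identityʳ _ ⟩
    f (suc n) ∎

  ⊛-distribʳ : ∀ (f f′ f″ : Series) g n → (∀ j → f j ≈ f′ j + f″ j) →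
    (f ⊛ g) n ≈ (f′ ⊛ g) n + (f″ ⊛ g) n
  ⊛-distribʳ f f′ f″ g zero eq = begin
    f 0 * g 0 + 0#             ≈⟨ +-congʳ (*-congʳ (eq 0)) ⟩
    (f′ 0 + f″ 0) * g 0 + 0#   ≈⟨ solve 3 (λ x y z → (x :+ y) :* z :+ :0
                                    := (x :* z :+ :0) :+ (y :* z :+ :0)) refl _ _ _ ⟩
    (f′ 0 * g 0 + 0#) + (f″ 0 * g 0 + 0#) ∎
  ⊛-distribʳ f f′ f″ g (suc n) eq = begin
    f 0 * g (suc n) + ((f ∘ suc) ⊛ g) n
      ≈⟨ +-cong (*-congʳ (eq 0)) (⊛-distribʳ (f ∘ suc) (f′ ∘ suc) (f″ ∘ suc) g n (eq ∘ suc)) ⟩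
    (f′ 0 + f″ 0) * g (suc n) + (((f′ ∘ suc) ⊛ g) n + ((f″ ∘ suc) ⊛ g) n)
      ≈⟨ solve 5 (λ x y z u v → (x :+ y) :* z :+ (u :+ v)
           := (x :* z :+ u) :+ (y :* z :+ v)) refl _ _ _ _ _ ⟩
    (f′ ⊛ g) (suc n) + (f″ ⊛ g) (suc n) ∎

  -- Multiplication by f = f′ + x f″.
  ⊛-shiftˡ : ∀ (f f′ f″ : Series) g n → f 0 ≈ f′ 0 →
    (∀ j → f (suc j) ≈ f′ (suc j) + f″ j) →
    (f ⊛ g) (suc n) ≈ (f′ ⊛ g) (suc n) + (f″ ⊛ g) n
  ⊛-shiftˡ f f′ f″ g n eq₀ eq₁ =
    trans (+-cong (*-congʳ eq₀) (⊛-distribʳ (f ∘ suc) (f′ ∘ suc) f″ g n eq₁)) (sym (+-assoc _ _ _))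

  -- Multiplication by g = g′ + x g″. Unfolding a product peels off coefficients of the left factor,
  -- so a change in the right factor takes an induction, and `g 0` surfaces only in its base case.
  ⊛-shiftʳ : ∀ (f g g′ g″ : Series) n → g 0 ≈ g′ 0 →
    (∀ j → g (suc j) ≈ g′ (suc j) + g″ j) →
    (f ⊛ g) (suc n) ≈ (f ⊛ g′) (suc n) + (f ⊛ g″) n
  ⊛-shiftʳ f g g′ g″ zero eq₀ eq₁ = begin
    f 0 * g 1 + (f 1 * g 0 + 0#)
      ≈⟨ +-cong (*-congˡ (eq₁ 0)) (+-congʳ (*-congˡ eq₀)) ⟩
    f 0 * (g′ 1 + g″ 0) + (f 1 * g′ 0 + 0#)
      ≈⟨ solve 5 (λ x y u v w → x :* (u :+ v) :+ (y :* w :+ :0)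
           := (x :* u :+ (y :* w :+ :0)) :+ (x :* v :+ :0)) refl _ _ _ _ _ ⟩
    (f ⊛ g′) 1 + (f ⊛ g″) 0 ∎
  ⊛-shiftʳ f g g′ g″ (suc n) eq₀ eq₁ = begin
    f 0 * g (suc (suc n)) + ((f ∘ suc) ⊛ g) (suc n)
      ≈⟨ +-cong (*-congˡ (eq₁ (suc n))) (⊛-shiftʳ (f ∘ suc) g g′ g″ n eq₀ eq₁) ⟩
    f 0 * (g′ (suc (suc n)) + g″ (suc n))
      + (((f ∘ suc) ⊛ g′) (suc n) + ((f ∘ suc) ⊛ g″) n)
      ≈⟨ solve 5 (λ x u v y z → x :* (u :+ v) :+ (y :+ z)
           := (x :* u :+ y) :+ (x :* v :+ z)) refl _ _ _ _ _ ⟩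
    (f ⊛ g′) (suc (suc n)) + (f ⊛ g″) (suc n) ∎

-- Continued fractions as weighted lattice paths

module ContinuedFraction {c ℓ} (R : CommutativeRing c ℓ) where

  open Over R
  open IntegerSolver R
  open Convolution R
  open SemiringSum semiring using (sum-cong-≋)
  open SetoidReasoning setoid

  -- paths b (suc m) n is the total weight of the paths with steps ±1 from
  -- height 0 to height m that stay nonnegative and have n down steps, a down
  -- step from height i + 1 having weight b i.  The empty path is entered by a
  -- fictitious step from height -1, hence paths b 0 = one.
  paths : (ℕ → Carrier) → ℕ → Series
  paths b zero    n       = one n
  paths b (suc m) zero    = 1#
  paths b (suc m) (suc n) = paths b m (suc n) + b m * paths b (suc (suc m)) n

  paths-0 : ∀ b m → paths b m 0 ≈ 1#
  paths-0 b zero    = refl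
  paths-0 b (suc m) = refl

  -- Decomposition at the last visit to height 0.
  paths-⊛ : ∀ b n m → (paths (b ∘ suc) m ⊛ paths b 1) n ≈ paths b (suc m) n
  paths-⊛ b n       zero    = one-⊛ (paths b 1) n
  paths-⊛ b zero    (suc m) = solve 0 (:1 :* :1 :+ :0 := :1) refl
  paths-⊛ b (suc n) (suc m) = begin
    (paths b′ (suc m) ⊛ K) (suc n)
      ≈⟨ ⊛-shiftˡ (paths b′ (suc m)) (paths b′ m) (b (suc m) · paths b′ (suc (suc m)))
           K n (sym (paths-0 b′ m)) (λ j → refl) ⟩
    (paths b′ m ⊛ K) (suc n) + ((b (suc m) · paths b′ (suc (suc m))) ⊛ K) n
      ≈⟨ +-cong (paths-⊛ b (suc n) m)
                (trans (·-⊛ (b (suc m)) (paths b′ (suc (suc m))) K n)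
                       (*-congˡ (paths-⊛ b n (suc (suc m))))) ⟩
    paths b (suc (suc m)) (suc n) ∎
    where
    b′ = b ∘ suc
    K  = paths b 1

  -- The equation f = 1 + x g′ f determines f coefficient by coefficient. The bound `N` makes the
  -- strong induction on `n` structural, and agreement of `g` and `g′` below `N` is all that a
  -- convergent of finite depth can supply.
  1/1-x-unique : ∀ {g g′ f : Series} → f 0 ≈ 1# → (∀ n → f (suc n) ≈ (g′ ⊛ f) n) →
    ∀ N → (∀ i → i ℕ.< N → g i ≈ g′ i) → ∀ n → n ℕ.≤ N → (1/1-x g) n ≈ f n
  1/1-x-unique f₀ f₊ N       g≈g′ zero    n≤N       = sym f₀
  1/1-x-unique {g} {g′} {f} f₀ f₊ (suc N) g≈g′ (suc n) (s≤s n≤N) = begin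
    recSum g n 0            ≈⟨ recSum-sum g n 0 ⟩
    (g ⊛ (1/1-x g)) n
      ≈⟨ sum-cong-≋ {suc n} (λ i → *-cong
           (g≈g′ (toℕ i) (s≤s (ℕ.≤-trans (toℕ≤pred[n] i) n≤N)))
           (1/1-x-unique {f = f} f₀ f₊ N (λ i i<N → g≈g′ i (ℕ.m<n⇒m<1+n i<N)) _
             (ℕ.≤-trans (ℕ.m∸n≤m n (toℕ i)) n≤N))) ⟩
    (g′ ⊛ f) n              ≈⟨ f₊ n ⟨
    f (suc n)               ∎

  -- A nonempty path from 0 to 0 ends with a down step from height 1, and the part before that step
  -- splits at its last visit to 0. Hence K = 1 + b₀ x K′ K, with K′ the series for the shifted
  -- weights; this is one level of the fraction.
  convergent-paths : ∀ a b m → (∀ i → a (m ℕ.+ i) ≈ b i) →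
    ∀ N n → n ℕ.≤ N → convergent a m N n ≈ paths b 1 n
  convergent-paths a b m a≈b zero    zero z≤n = refl
  convergent-paths a b m a≈b (suc N) n    n≤N =
    1/1-x-unique {g′ = b 0 · paths (b ∘ suc) 1} refl paths-suc (suc N)
      (λ { i (s≤s i≤N) → *-cong
             (trans (reflexive (≡.cong a (≡.sym (ℕ.+-identityʳ m)))) (a≈b 0))
             (convergent-paths a (b ∘ suc) (suc m)
               (λ i → trans (reflexive (≡.cong a (≡.sym (ℕ.+-suc m i)))) (a≈b (suc i)))
               N i i≤N) })
      n n≤N
    where
    paths-suc : ∀ n → paths b 1 (suc n) ≈ ((b 0 · paths (b ∘ suc) 1) ⊛ paths b 1) n
    paths-suc n = begin
      0# + b 0 * paths b 2 n                    ≈⟨ +-identityˡ _ ⟩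
      b 0 * paths b 2 n                         ≈⟨ *-congˡ (paths-⊛ b n 1) ⟨
      b 0 * (paths (b ∘ suc) 1 ⊛ paths b 1) n   ≈⟨ ·-⊛ (b 0) (paths (b ∘ suc) 1) (paths b 1) n ⟨
      ((b 0 · paths (b ∘ suc) 1) ⊛ paths b 1) n ∎

-- Ballot numbers

module Ballot {c ℓ} (R : CommutativeRing c ℓ) where

  open Over R
  open IntegerSolver R
  open MonoidMult +-monoid using (×-homo-+; ×-congˡ)

  -- The coefficient of z^d in (1 - z)(1 + z)^L. By Lagrange inversion for x = z / (1 + z)², the
  -- coefficient of x^n in (1 + z)^m z^k is `ballot` at m + 2n - 1 and n - k.
  ballot : ℕ → Series
  ballot L d = binom L (+ d) × 1# - binom L (+ d ℤ.- + 1) × 1#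

  ballot-0 : ∀ L → ballot L 0 ≈ 1#
  ballot-0 L = solve 0 (:1 :+ :0 :- :0 := :1) refl

  ballot-pascal : ∀ L d → ballot (suc L) (suc d) ≈ ballot L (suc d) + ballot L d
  -- Here `ballot L 0` contains a binomial with lower index -1, which Pascal's rule for `_C_` does
  -- not cover.
  ballot-pascal L zero = trans
    (+-congʳ (trans (×-congˡ (≡.sym (nCk+nC[k+1]≡[n+1]C[k+1] L 0))) (×-homo-+ 1# 1 (L C 1))))
    (solve 1 (λ x → :1 :+ :0 :+ x :- (:1 :+ :0) := x :- (:1 :+ :0) :+ (:1 :+ :0 :- :0))
       refl ((L C 1) × 1#))
  ballot-pascal L (suc d) = trans
    (+-cong (pascal (suc d)) (-‿cong (pascal d)))
    (solve 3 (λ x y z → y :+ z :- (x :+ y) := z :- y :+ (y :- x)) refl _ _ _)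
    where
    pascal : ∀ k → (suc L C suc k) × 1# ≈ (L C k) × 1# + (L C suc k) × 1#
    pascal k = trans (×-congˡ (≡.sym (nCk+nC[k+1]≡[n+1]C[k+1] L k)))
                     (×-homo-+ 1# (L C k) (L C suc k))

  -- The two middle entries of an odd row of Pascal's triangle agree. This is the boundary condition
  -- that matches `paths b 0 = one`.
  ballot-vanishes : ∀ n L → L ≡ suc (n ℕ.+ n) → ballot L (suc n) ≈ 0#
  ballot-vanishes n L ≡.refl = trans (+-congʳ (×-congˡ symmetric)) (-‿inverseʳ _)
    where
    symmetric : suc (n ℕ.+ n) C suc n ≡ suc (n ℕ.+ n) C n
    symmetric = ≡.trans (nCk≡nC[n∸k] (s≤s (ℕ.m≤m+n n n)))
                        (≡.cong (suc (n ℕ.+ n) C_) (ℕ.m+n∸m≡n n n))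

-- Ballot expansion of the path series

module Euler {c ℓ} (R : CommutativeRing c ℓ) (t q : CommutativeRing.Carrier R) where

  open Over R
  open IntegerSolver R
  open Convolution R
  open ContinuedFraction R
  open Ballot R
  open SetoidReasoning setoid

  Λ : ℕ → Carrier
  Λ m = (1# - q ^ m) * (1# - t * q ^ m)

  :Λ : ∀ {n} (t y : Polynomial n) → Polynomial n
  :Λ t y = (:1 :- y) :* (:1 :- t :* y)

  -- A m k is the coefficient of z^(k-1) in the series A_{m-1} of the header.
  A : ℕ → Series
  A m             zero          = 0#
  A zero          (suc zero)    = 1#
  A zero          (suc (suc k)) = 0#
  A (suc m)       (suc k)       = A m (suc k) - A (suc m) k + Λ (suc m) * A (suc (suc m)) k

  A-at-1 : ∀ m → A m 1 ≈ 1#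
  A-at-1 zero    = refl
  A-at-1 (suc m) = trans (+-congʳ (+-congʳ (A-at-1 m)))
    (solve 1 (λ x → :1 :- :0 :+ x :* :0 := :1) refl (Λ (suc m)))

  A⁺ : ℕ → Series
  A⁺ m k = A m (suc k)

  A⁺-0-⊛ : ∀ g n → (A⁺ 0 ⊛ g) n ≈ g n
  A⁺-0-⊛ g zero    = one-⊛ g zero
  A⁺-0-⊛ g (suc n) = one-⊛ g (suc n)

  -- The auxiliary series `f` is (1 + z) times `A⁺ (suc m)`; it is split once by this product and
  -- once by the recursion of `A`.
  A⁺-⊛ : ∀ m g n → (A⁺ (suc m) ⊛ g) (suc n) + (A⁺ (suc m) ⊛ g) n ≈
    (A⁺ m ⊛ g) (suc n) + Λ (suc m) * (A⁺ (suc (suc m)) ⊛ g) n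
  A⁺-⊛ m g n = begin
    (A⁺ (suc m) ⊛ g) (suc n) + (A⁺ (suc m) ⊛ g) n
      ≈⟨ ⊛-shiftˡ f (A⁺ (suc m)) (A⁺ (suc m)) g n refl (λ j → refl) ⟨
    (f ⊛ g) (suc n)
      ≈⟨ ⊛-shiftˡ f (A⁺ m) (Λ (suc m) · A⁺ (suc (suc m))) g n
           (trans (A-at-1 (suc m)) (sym (A-at-1 m)))
           (λ j → solve 3 (λ x y z → x :- y :+ z :+ y := x :+ z) refl _ _ _) ⟩
    (A⁺ m ⊛ g) (suc n) + ((Λ (suc m) · A⁺ (suc (suc m))) ⊛ g) n
      ≈⟨ +-congˡ (·-⊛ (Λ (suc m)) (A⁺ (suc (suc m))) g n) ⟩
    (A⁺ m ⊛ g) (suc n) + Λ (suc m) * (A⁺ (suc (suc m)) ⊛ g) n ∎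
    where
    f : Series
    f zero    = A⁺ (suc m) zero
    f (suc j) = A⁺ (suc m) (suc j) + A⁺ (suc m) j

  -- L = m + 2n - 1 is written additively, so m = n = 0 is excluded.
  paths-ballot : ∀ ρ n m L → suc L ≡ m ℕ.+ (n ℕ.+ n) →
    paths (λ i → ρ * Λ (suc i)) m n ≈ ρ ^ n * (A⁺ m ⊛ ballot L) n
  paths-ballot ρ zero zero L ()
  paths-ballot ρ zero (suc m) L eq = sym (begin
    1# * (A (suc m) 1 * ballot L 0 + 0#)
      ≈⟨ *-congˡ (+-congʳ (*-cong (A-at-1 (suc m)) (ballot-0 L))) ⟩
    1# * (1# * 1# + 0#)
      ≈⟨ solve 0 (:1 :* (:1 :* :1 :+ :0) := :1) refl ⟩
    1# ∎)
  paths-ballot ρ (suc n) zero L eq = sym (begin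
    ρ ^ suc n * (A⁺ 0 ⊛ ballot L) (suc n) ≈⟨ *-congˡ (A⁺-0-⊛ (ballot L) (suc n)) ⟩
    ρ ^ suc n * ballot L (suc n)
      ≈⟨ *-congˡ (ballot-vanishes n L
           (≡.trans (ℕ.suc-injective eq) (ℕ.+-suc n n))) ⟩
    ρ ^ suc n * 0#                        ≈⟨ zeroʳ _ ⟩
    0#                                    ∎)
  paths-ballot ρ (suc n) (suc m) zero eq
    with () ← ≡.trans (ℕ.suc-injective eq) (ℕ.+-suc m (n ℕ.+ suc n))
  paths-ballot ρ (suc n) (suc m) (suc L) eq = begin
    paths b m (suc n) + ρ * Λ (suc m) * paths b (suc (suc m)) n
      ≈⟨ +-cong (paths-ballot ρ (suc n) m L (ℕ.suc-injective eq))
                (*-congˡ (paths-ballot ρ n (suc (suc m)) L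
                  (≡.trans (ℕ.suc-injective eq) (reindex m n)))) ⟩
    ρ ^ suc n * (A⁺ m ⊛ β) (suc n)
      + ρ * Λ (suc m) * (ρ ^ n * (A⁺ (suc (suc m)) ⊛ β) n)
      ≈⟨ solve 5 (λ r s l x y → r :* s :* x :+ r :* l :* (s :* y)
           := r :* s :* (x :+ l :* y)) refl ρ (ρ ^ n) (Λ (suc m)) _ _ ⟩
    ρ ^ suc n * ((A⁺ m ⊛ β) (suc n) + Λ (suc m) * (A⁺ (suc (suc m)) ⊛ β) n)
      -- The recursion of `A` leaves a factor 1 + z, which Pascal's rule absorbs into the ballot
      -- numbers by raising `L` to `suc L`.
      ≈⟨ *-congˡ (A⁺-⊛ m β n) ⟨
    ρ ^ suc n * ((A⁺ (suc m) ⊛ β) (suc n) + (A⁺ (suc m) ⊛ β) n)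
      ≈⟨ *-congˡ (⊛-shiftʳ (A⁺ (suc m)) (ballot (suc L)) β β n
           (trans (ballot-0 (suc L)) (sym (ballot-0 L))) (ballot-pascal L)) ⟨
    ρ ^ suc n * (A⁺ (suc m) ⊛ ballot (suc L)) (suc n) ∎
    where
    b = λ i → ρ * Λ (suc i)
    β = ballot L
    reindex : ∀ m n → m ℕ.+ (suc n ℕ.+ suc n) ≡ suc (suc m) ℕ.+ (n ℕ.+ n)
    reindex = ℕ.solve-∀

  -- The q-difference equation

  module _ (q⁻¹ : Carrier) (qq⁻¹≈1 : q * q⁻¹ ≈ 1#) where

    -- In the q-difference equation, y = q^(m+1) and w = q^k; a and b stand for
    -- consecutive coefficients of A_m and λ (m+1) A_{m+1}.
    residual : (y w a₁ a₀ b₁ b₀ : Carrier) → Carrier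
    residual y w a₁ a₀ b₁ b₀ =
      (y * y) * (w * w) * (t * a₁ + q⁻¹ * a₀)
      - ((b₁ - a₁) - q * (b₀ - a₀) + y * (1# + t) * a₁)

    :residual : ∀ {n} (t q p y w a₁ a₀ b₁ b₀ : Polynomial n) → Polynomial n
    :residual t q p y w a₁ a₀ b₁ b₀ =
      (y :* y) :* (w :* w) :* (t :* a₁ :+ p :* a₀)
      :- ((b₁ :- a₁) :- q :* (b₀ :- a₀) :+ y :* (:1 :+ t) :* a₁)

    residual-cong : ∀ {y w a₁ a₀ b₁ b₀ a₁′ a₀′ b₁′ b₀′} →
      a₁ ≈ a₁′ → a₀ ≈ a₀′ → b₁ ≈ b₁′ → b₀ ≈ b₀′ →
      residual y w a₁ a₀ b₁ b₀ ≈ residual y w a₁′ a₀′ b₁′ b₀′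
    residual-cong eq₁ eq₂ eq₃ eq₄ = +-cong
      (*-congˡ (+-cong (*-congˡ eq₁) (*-congˡ eq₂)))
      (-‿cong (+-cong (+-cong (+-cong eq₃ (-‿cong eq₁))
                              (-‿cong (*-congˡ (+-cong eq₄ (-‿cong eq₂)))))
                      (*-congˡ eq₁)))

    -- The coefficient of z^k in the difference of the two sides for A_{m-1}. The `q⁻¹` in
    -- `residual` comes from q · q^(2(k-1)) = q^(2k) q⁻¹; at k = 0 it meets `A m 0`, which is 0.
    defect : ℕ → ℕ → Carrier
    defect m k = residual (q ^ m) (q ^ k)
      (A m (suc k)) (A m k) (Λ m * A (suc m) (suc k)) (Λ m * A (suc m) k)

    -- All constant terms are 1, so this is (1 - y)(1 - t y) - 1 + y (1 + t) = t y² with y = q^m.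
    defect-m0 : ∀ m → defect m 0 ≈ 0#
    defect-m0 m = trans
      (residual-cong (A-at-1 m) refl (*-congˡ (A-at-1 (suc m))) refl)
      (solve 4 (λ y t q p →
         :residual t q p y :1 :1 :0 (:Λ t y :* :1) (:Λ t y :* :0) := :0)
         refl (q ^ m) t q q⁻¹)

    defect-01 : defect 0 1 ≈ 0#
    defect-01 = begin
      defect 0 1
        ≈⟨ solve 5 (λ t q p a b →
             :residual t q p :1 (q :* :1) :0 :1 (:Λ t :1 :* a) (:Λ t :1 :* b)
             := q :* (q :* p :- :1)) refl t q q⁻¹ (A 1 2) (A 1 1) ⟩
      q * (q * q⁻¹ - 1#) ≈⟨ *-congˡ (trans (+-congʳ qq⁻¹≈1) (-‿inverseʳ 1#)) ⟩
      q * 0#             ≈⟨ zeroʳ q ⟩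
      0#                 ∎

    defect-0 : ∀ k → defect 0 k ≈ 0#
    defect-0 zero          = defect-m0 0
    defect-0 (suc zero)    = defect-01
    defect-0 (suc (suc k)) = solve 6 (λ w t q p a b →
      :residual t q p :1 w :0 :0 (:Λ t :1 :* a) (:Λ t :1 :* b) := :0)
      refl (q ^ suc (suc k)) t q q⁻¹ (A 1 (suc (suc (suc k)))) (A 1 (suc (suc k)))

    defect-step : ∀ m k → defect (suc m) (suc k) ≈
      q * q * defect m (suc k) - q * q * defect (suc m) k
        + Λ (suc m) * defect (suc (suc m)) k
    defect-step m k = begin
      defect (suc m) (suc k)
        -- A polynomial identity in coefficients of the rows m + 1 and m + 2 only: the recursion of
        -- `A` expresses row m (`lower`) and the multiple of row m + 3 (`upper`) through these two.
        ≈⟨ solve 11 (λ t q p y w b₂ b₁ b₀ c₂ c₁ c₀ →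
             let l = :Λ t (q :* y) in
             :residual t q p (q :* y) (q :* w) b₂ b₁ (l :* c₂) (l :* c₁)
             := q :* q :* :residual t q p y (q :* w)
                            (b₂ :+ b₁ :- l :* c₁) (b₁ :+ b₀ :- l :* c₀)
                            (:Λ t y :* b₂) (:Λ t y :* b₁)
                :- q :* q :* :residual t q p (q :* y) w b₁ b₀ (l :* c₁) (l :* c₀)
                :+ l :* :residual t q p (q :* (q :* y)) w c₁ c₀
                          (c₂ :+ c₁ :- b₂) (c₁ :+ c₀ :- b₁))
             refl t q q⁻¹ (q ^ m) (q ^ k)
             (A (suc m) (suc (suc k))) (A (suc m) (suc k)) (A (suc m) k)
             (A (suc (suc m)) (suc (suc k))) (A (suc (suc m)) (suc k)) (A (suc (suc m)) k) ⟩
      q * q * residual (q ^ m) (q ^ suc k)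
                (A (suc m) (suc (suc k)) + A (suc m) (suc k) - Λ (suc m) * A (suc (suc m)) (suc k))
                (A (suc m) (suc k) + A (suc m) k - Λ (suc m) * A (suc (suc m)) k)
                (Λ m * A (suc m) (suc (suc k))) (Λ m * A (suc m) (suc k))
        - q * q * defect (suc m) k
        + Λ (suc m) * residual (q ^ suc (suc m)) (q ^ k)
            (A (suc (suc m)) (suc k)) (A (suc (suc m)) k)
            (A (suc (suc m)) (suc (suc k)) + A (suc (suc m)) (suc k) - A (suc m) (suc (suc k)))
            (A (suc (suc m)) (suc k) + A (suc (suc m)) k - A (suc m) (suc k))
        ≈⟨ +-cong (+-congʳ (*-congˡ (residual-cong (lower (suc k)) (lower k) refl refl)))
                  (*-congˡ (residual-cong refl refl (upper (suc k)) (upper k))) ⟩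
      q * q * defect m (suc k) - q * q * defect (suc m) k
        + Λ (suc m) * defect (suc (suc m)) k ∎
      where
      lower : ∀ k → A (suc m) (suc k) + A (suc m) k - Λ (suc m) * A (suc (suc m)) k
                    ≈ A m (suc k)
      lower k = solve 3 (λ x y z → x :- y :+ z :+ y :- z := x) refl _ _ _
      upper : ∀ k → A (suc (suc m)) (suc k) + A (suc (suc m)) k - A (suc m) (suc k)
                    ≈ Λ (suc (suc m)) * A (suc (suc (suc m))) k
      upper k = solve 3 (λ x y z → x :- y :+ z :+ y :- x := z) refl _ _ _

    -- `defect-step` either lowers k, possibly raising m, or keeps k and lowers m. So zero boundary
    -- values at m = 0 and k = 0 propagate everywhere.
    defect≈0 : ∀ m k → defect m k ≈ 0#
    defect≈0 zero    k       = defect-0 k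
    defect≈0 (suc m) zero    = defect-m0 (suc m)
    defect≈0 (suc m) (suc k) = begin
      defect (suc m) (suc k)
        ≈⟨ defect-step m k ⟩
      q * q * defect m (suc k) - q * q * defect (suc m) k
        + Λ (suc m) * defect (suc (suc m)) k
        ≈⟨ +-cong (+-cong (*-congˡ (defect≈0 m (suc k)))
                          (-‿cong (*-congˡ (defect≈0 (suc m) k))))
                  (*-congˡ (defect≈0 (suc (suc m)) k)) ⟩
      q * q * 0# - q * q * 0# + Λ (suc m) * 0#
        ≈⟨ solve 2 (λ q l → q :* q :* :0 :- q :* q :* :0 :+ l :* :0 := :0) refl q (Λ (suc m)) ⟩
      0# ∎

    A₁-at-2 : A 1 2 ≈ t * q * q - (t + 1#) * q
    A₁-at-2 = trans (+-cong (+-congˡ (-‿cong (A-at-1 1))) (*-congˡ (A-at-1 2)))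
      (solve 2 (λ t q → :0 :- :1 :+ :Λ t (q :* :1) :* :1
                        := t :* q :* q :- (t :+ :1) :* q) refl t q)

    -- The q-difference equation for A_0, from which A_1 is eliminated by λ 1 z A_1 = (1 + z) A_0 -
    -- 1. The differences `b₁ - a₁` and `b₀ - a₀` then become single coefficients of A_0.
    A₁-recurrence : ∀ k → A 1 (suc (suc (suc k))) ≈
      q * q * (q ^ suc k * q ^ suc k) * (t * A 1 (suc (suc k)) + q⁻¹ * A 1 (suc k))
        - q * t * A 1 (suc (suc k))
    A₁-recurrence k = begin
      A 1 (suc (suc (suc k)))
        ≈⟨ solve 7 (λ t q p w x₂ x₁ a₁ →
             let a₂ = :0 :- a₁ :+ x₁ in
             :0 :- a₂ :+ x₂
             := q :* q :* (w :* w) :* (t :* a₂ :+ p :* a₁) :- q :* t :* a₂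
                :- :residual t q p (q :* :1) w a₂ a₁ x₂ x₁)
             refl t q q⁻¹ (q ^ suc k) (Λ 1 * A 2 (suc (suc k))) (Λ 1 * A 2 (suc k)) (A 1 (suc k)) ⟩
      rhs - defect 1 (suc k) ≈⟨ +-congˡ (-‿cong (defect≈0 1 (suc k))) ⟩
      rhs - 0#               ≈⟨ solve 1 (λ x → x :- :0 := x) refl rhs ⟩
      rhs                    ∎
      where
      rhs = q * q * (q ^ suc k * q ^ suc k) * (t * A 1 (suc (suc k)) + q⁻¹ * A 1 (suc k))
              - q * t * A 1 (suc (suc k))

-- Three-term recurrence for T_k

module TPolynomials {c ℓ} (R : CommutativeRing c ℓ) (τ p : CommutativeRing.Carrier R) where

  open Over R
  open IntegerSolver R
  open SemiringExp semiring using (^-congʳ; ^-homo-*)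
  open SetoidReasoning setoid

  square-suc : ∀ k → suc (suc k) ℕ.* suc (suc k) ≡ 3 ℕ.+ (k ℕ.+ k) ℕ.+ suc k ℕ.* suc k
  square-suc = ℕ.solve-∀

  -- Each exponent grows by (k + 2)² - (k + 1)² = 2k + 3; the bound on `j` keeps the truncated
  -- subtractions exact.
  T-sum-suc : ∀ k j → j ℕ.≤ suc k →
    T-sum (suc (suc k)) j τ p ≈ (- p) ^ (3 ℕ.+ (k ℕ.+ k)) * T-sum (suc k) j τ p
  T-sum-suc k zero    _   = sym (zeroʳ _)
  T-sum-suc k (suc j) j<k = begin
    T-sum (suc (suc k)) j τ p
      + (- p) ^ (suc (suc k) ℕ.* suc (suc k) ∸ suc j ℕ.* suc j) * T j τ p
      ≈⟨ +-cong (T-sum-suc k j (ℕ.<⇒≤ j<k))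
                (*-congʳ (trans (^-congʳ (- p) exponent) (^-homo-* (- p) d e))) ⟩
    (- p) ^ d * T-sum (suc k) j τ p + (- p) ^ d * (- p) ^ e * T j τ p
      ≈⟨ solve 4 (λ x y z w → x :* y :+ x :* z :* w := x :* (y :+ z :* w)) refl _ _ _ _ ⟩
    (- p) ^ d * (T-sum (suc k) j τ p + (- p) ^ e * T j τ p) ∎
    where
    d = 3 ℕ.+ (k ℕ.+ k)
    e = suc k ℕ.* suc k ∸ suc j ℕ.* suc j
    exponent : suc (suc k) ℕ.* suc (suc k) ∸ suc j ℕ.* suc j ≡ d ℕ.+ e
    exponent = ≡.trans (≡.cong (_∸ suc j ℕ.* suc j) (square-suc k))
                       (ℕ.+-∸-assoc d (ℕ.*-mono-≤ j<k j<k))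

  -- Subtracting (-p)^(2k+3) times the recurrence for T_{k+1} from that for T_{k+2} cancels
  -- everything in the sum except its new last term, a multiple of T_k whose power of -p has
  -- exponent 0 before scaling.
  T-three-term : ∀ k → T (suc (suc k)) τ p ≈
    (1# + (- p) ^ (3 ℕ.+ (k ℕ.+ k))) * T (suc k) τ p
      - τ * τ * (- p) ^ (3 ℕ.+ (k ℕ.+ k)) * T k τ p
  T-three-term k = begin
    T (suc k) τ p + (1# + τ) * (- p) ^ (suc (suc k) ℕ.* suc (suc k))
      + (1# - τ * τ) * T-sum (suc (suc k)) (suc k) τ p
      ≈⟨ +-cong (+-congˡ (*-congˡ (trans (^-congʳ (- p) (square-suc k)) (^-homo-* (- p) d _))))
                (*-congˡ (T-sum-suc k (suc k) ℕ.≤-refl)) ⟩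
    T (suc k) τ p + (1# + τ) * (x * g)
      + (1# - τ * τ) * (x * (S + (- p) ^ (suc k ℕ.* suc k ∸ suc k ℕ.* suc k) * T k τ p))
      ≈⟨ +-congˡ (*-congˡ (*-congˡ (+-congˡ
           (*-congʳ (^-congʳ (- p) (ℕ.n∸n≡0 (suc k ℕ.* suc k))))))) ⟩
    T (suc k) τ p + (1# + τ) * (x * g) + (1# - τ * τ) * (x * (S + 1# * T k τ p))
      ≈⟨ solve 5 (λ τ x g s u →
           let v = u :+ (:1 :+ τ) :* g :+ (:1 :- τ :* τ) :* s in
           v :+ (:1 :+ τ) :* (x :* g) :+ (:1 :- τ :* τ) :* (x :* (s :+ :1 :* u))
           := (:1 :+ x) :* v :- τ :* τ :* x :* u) refl τ x g S (T k τ p) ⟩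
    (1# + x) * T (suc k) τ p - τ * τ * x * T k τ p ∎
    where
    d = 3 ℕ.+ (k ℕ.+ k)
    x = (- p) ^ d
    g = (- p) ^ (suc k ℕ.* suc k)
    S = T-sum (suc k) k τ p

-- The reversed polynomials t^k q^(k(k+1)) T_k (1/t, 1/q)

module Reversed {c ℓ} (R : CommutativeRing c ℓ)
  (t q t⁻¹ q⁻¹ : CommutativeRing.Carrier R) where

  open Over R
  open IntegerSolver R
  open SemiringExp semiring using (^-congʳ; ^-homo-*)
  open Euler R t q
  open TPolynomials R t⁻¹ q⁻¹
  open SetoidReasoning setoid

  P : ℕ → Carrier
  P k = t ^ k * q ^ (k ℕ.* (k ℕ.+ 1)) * T k t⁻¹ q⁻¹

  q-power : ∀ k → q ^ (suc k ℕ.* (suc k ℕ.+ 1)) ≈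
    q * q * (q ^ k * q ^ k) * q ^ (k ℕ.* (k ℕ.+ 1))
  q-power k = begin
    q ^ (suc k ℕ.* (suc k ℕ.+ 1))                   ≈⟨ ^-congʳ q (exponent k) ⟩
    q ^ (2 ℕ.+ (k ℕ.+ k) ℕ.+ k ℕ.* (k ℕ.+ 1))       ≈⟨ ^-homo-* q (2 ℕ.+ (k ℕ.+ k)) _ ⟩
    q * (q * q ^ (k ℕ.+ k)) * q ^ (k ℕ.* (k ℕ.+ 1)) ≈⟨ *-congʳ (sym (*-assoc q q _)) ⟩
    q * q * q ^ (k ℕ.+ k) * q ^ (k ℕ.* (k ℕ.+ 1))
      ≈⟨ *-congʳ (*-congˡ (^-homo-* q k k)) ⟩
    q * q * (q ^ k * q ^ k) * q ^ (k ℕ.* (k ℕ.+ 1)) ∎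
    where
    exponent : ∀ k → suc k ℕ.* (suc k ℕ.+ 1) ≡ 2 ℕ.+ (k ℕ.+ k) ℕ.+ k ℕ.* (k ℕ.+ 1)
    exponent = ℕ.solve-∀

  module _ (tt⁻¹≈1 : t * t⁻¹ ≈ 1#) (qq⁻¹≈1 : q * q⁻¹ ≈ 1#) where

    even-power : ∀ k → (- q⁻¹) ^ k * q ^ k * ((- q⁻¹) ^ k * q ^ k) ≈ 1#
    even-power zero    = solve 0 (:1 :* :1 :* (:1 :* :1) := :1) refl
    even-power (suc k) = begin
      (- q⁻¹) ^ suc k * q ^ suc k * ((- q⁻¹) ^ suc k * q ^ suc k)
        ≈⟨ solve 4 (λ q p x w → :- p :* x :* (q :* w) :* (:- p :* x :* (q :* w))
             := q :* p :* (q :* p) :* (x :* w :* (x :* w))) refl q q⁻¹ _ _ ⟩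
      q * q⁻¹ * (q * q⁻¹) * ((- q⁻¹) ^ k * q ^ k * ((- q⁻¹) ^ k * q ^ k))
        ≈⟨ *-cong (*-cong qq⁻¹≈1 qq⁻¹≈1) (even-power k) ⟩
      1# * 1# * 1#
        ≈⟨ solve 0 (:1 :* :1 :* :1 := :1) refl ⟩
      1# ∎

    -- The factor q^(2k+3) reduces the power occurring in `T-three-term` to its sign, which is -1
    -- because the exponent is odd.
    odd-power : ∀ k → (- q⁻¹) ^ (3 ℕ.+ (k ℕ.+ k)) * (q * q * q * (q ^ k * q ^ k)) ≈ - 1#
    odd-power k = begin
      (- q⁻¹) ^ (3 ℕ.+ (k ℕ.+ k)) * (q * q * q * (q ^ k * q ^ k))
        ≈⟨ *-congʳ (*-congˡ (*-congˡ (*-congˡ (^-homo-* (- q⁻¹) k k)))) ⟩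
      - q⁻¹ * (- q⁻¹ * (- q⁻¹ * ((- q⁻¹) ^ k * (- q⁻¹) ^ k))) * (q * q * q * (q ^ k * q ^ k))
        ≈⟨ solve 4 (λ q p x w →
             :- p :* (:- p :* (:- p :* (x :* x))) :* (q :* q :* q :* (w :* w))
             := :- (q :* p :* (q :* p) :* (q :* p)) :* (x :* w :* (x :* w)))
             refl q q⁻¹ _ _ ⟩
      - (q * q⁻¹ * (q * q⁻¹) * (q * q⁻¹)) * ((- q⁻¹) ^ k * q ^ k * ((- q⁻¹) ^ k * q ^ k))
        ≈⟨ *-cong (-‿cong (*-cong (*-cong qq⁻¹≈1 qq⁻¹≈1) qq⁻¹≈1)) (even-power k) ⟩
      - (1# * 1# * 1#) * 1#
        ≈⟨ solve 0 (:- (:1 :* :1 :* :1) :* :1 := :- :1) refl ⟩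
      - 1# ∎

    P-at-1 : P 1 ≈ t * q * q - (t + 1#) * q
    P-at-1 = begin
      P 1
        ≈⟨ solve 4 (λ t q u p →
             t :* :1 :* (q :* (q :* :1))
               :* (:1 :+ (:1 :+ u) :* (:- p :* :1) :+ (:1 :- u :* u) :* :0)
             := t :* q :* q :- (t :+ t :* u) :* (q :* (q :* p))) refl t q t⁻¹ q⁻¹ ⟩
      t * q * q - (t + t * t⁻¹) * (q * (q * q⁻¹))
        ≈⟨ +-congˡ (-‿cong (*-cong (+-congˡ tt⁻¹≈1)
             (trans (*-congˡ qq⁻¹≈1) (*-identityʳ q)))) ⟩
      t * q * q - (t + 1#) * q ∎

    -- `T-three-term` at the inverses, scaled by t^(k+2) q^((k+2)(k+3)); the form is that of
    -- `A₁-recurrence`.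
    P-recurrence : ∀ k → P (suc (suc k)) ≈
      q * q * (q ^ suc k * q ^ suc k) * (t * P (suc k) + q⁻¹ * P k) - q * t * P (suc k)
    P-recurrence k = begin
      P (suc (suc k))
        ≈⟨ *-cong (*-congˡ (trans (q-power (suc k)) (*-congˡ (q-power k)))) (T-three-term k) ⟩
      t * (t * t ^ k) * (q * q * (q * w * (q * w)) * (q * q * (w * w) * Q))
        * ((1# + x) * T₁ - t⁻¹ * t⁻¹ * x * T₀)
        ≈⟨ solve 9 (λ t q u w x tᵏ Q a b →
             let p₁ = t :* tᵏ :* (q :* q :* (w :* w) :* Q) :* a
                 m  = x :* (q :* q :* q :* (w :* w)) in
             t :* (t :* tᵏ) :* (q :* q :* (q :* w :* (q :* w)) :* (q :* q :* (w :* w) :* Q))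
               :* ((:1 :+ x) :* a :- u :* u :* x :* b)
             := (q :* q :* (q :* w :* (q :* w)) :* t :* p₁ :+ q :* t :* p₁ :* m)
                :- q :* q :* q :* (w :* w) :* (tᵏ :* Q :* b) :* (t :* u :* (t :* u) :* m))
             refl t q t⁻¹ w x (t ^ k) Q T₁ T₀ ⟩
      (q * q * (q * w * (q * w)) * t * P₁ + q * t * P₁ * (x * (q * q * q * (w * w))))
        - q * q * q * (w * w) * P k * (t * t⁻¹ * (t * t⁻¹) * (x * (q * q * q * (w * w))))
        ≈⟨ +-cong (+-congˡ (*-congˡ (odd-power k)))
                  (-‿cong (*-congˡ (*-cong (*-cong tt⁻¹≈1 tt⁻¹≈1) (odd-power k)))) ⟩
      (q * q * (q * w * (q * w)) * t * P₁ + q * t * P₁ * (- 1#))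
        - q * q * q * (w * w) * P k * (1# * 1# * (- 1#))
        ≈⟨ solve 5 (λ t q w a b →
             (q :* q :* (q :* w :* (q :* w)) :* t :* a :+ q :* t :* a :* (:- :1))
               :- q :* q :* q :* (w :* w) :* b :* (:1 :* :1 :* (:- :1))
             := q :* q :* (q :* w :* (q :* w)) :* t :* a :- q :* t :* a
                :+ q :* q :* q :* (w :* w) :* b :* :1) refl t q w P₁ (P k) ⟩
      q * q * (q * w * (q * w)) * t * P₁ - q * t * P₁ + q * q * q * (w * w) * P k * 1#
        -- The unit is expanded to `q * q⁻¹` so that q³ becomes q⁴ q⁻¹ and the common factor can be
        -- taken out.
        ≈⟨ +-congˡ (*-congˡ qq⁻¹≈1) ⟨
      q * q * (q * w * (q * w)) * t * P₁ - q * t * P₁ + q * q * q * (w * w) * P k * (q * q⁻¹)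
        ≈⟨ solve 6 (λ t q p w a b →
             q :* q :* (q :* w :* (q :* w)) :* t :* a :- q :* t :* a
               :+ q :* q :* q :* (w :* w) :* b :* (q :* p)
             := q :* q :* (q :* w :* (q :* w)) :* (t :* a :+ p :* b) :- q :* t :* a)
             refl t q q⁻¹ w P₁ (P k) ⟩
      q * q * (q * w * (q * w)) * (t * P₁ + q⁻¹ * P k) - q * t * P₁
        ≈⟨ +-cong (*-congˡ (+-congʳ (*-congˡ P₁≈P))) (-‿cong (*-congˡ P₁≈P)) ⟩
      q * q * (q * w * (q * w)) * (t * P (suc k) + q⁻¹ * P k) - q * t * P (suc k) ∎
      where
      w = q ^ k
      Q = q ^ (k ℕ.* (k ℕ.+ 1))
      x = (- q⁻¹) ^ (3 ℕ.+ (k ℕ.+ k))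
      T₁ = T (suc k) t⁻¹ q⁻¹
      T₀ = T k t⁻¹ q⁻¹
      P₁ = t ^ suc k * (q * q * (w * w) * Q) * T₁
      P₁≈P : P₁ ≈ P (suc k)
      P₁≈P = *-congʳ (*-congˡ (sym (q-power k)))

    -- Both sequences have the same two initial values and the same three-term recurrence.
    A₁≈P : ∀ k → A 1 (suc k) ≈ P k
    A₁≈P zero          = trans (A-at-1 1) (solve 0 (:1 := :1 :* :1 :* :1) refl)
    A₁≈P (suc zero)    = trans (A₁-at-2 q⁻¹ qq⁻¹≈1) (sym P-at-1)
    A₁≈P (suc (suc k)) = begin
      A 1 (suc (suc (suc k)))
        ≈⟨ A₁-recurrence q⁻¹ qq⁻¹≈1 k ⟩
      q * q * (q ^ suc k * q ^ suc k) * (t * A 1 (suc (suc k)) + q⁻¹ * A 1 (suc k))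
        - q * t * A 1 (suc (suc k))
        ≈⟨ +-cong (*-congˡ (+-cong (*-congˡ (A₁≈P (suc k))) (*-congˡ (A₁≈P k))))
                  (-‿cong (*-congˡ (A₁≈P (suc k)))) ⟩
      q * q * (q ^ suc k * q ^ suc k) * (t * P (suc k) + q⁻¹ * P k) - q * t * P (suc k)
        ≈⟨ P-recurrence k ⟨
      P (suc (suc k)) ∎

-- The formula for the Euler numbers

theorem1p1 : ∀ {c ℓ} (R : CommutativeRing c ℓ) →
    let open Over R in
    (t q t⁻¹ q⁻¹ 1/[1-q] : Carrier) →
    t * t⁻¹ ≈ 1# →
    q * q⁻¹ ≈ 1# →
    (1# - q) * 1/[1-q] ≈ 1# →
    ∀ (n : ℕ) →
    E t q 1/[1-q] n ≈
    1/[1-q] ^ (2 ℕ.* n) *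
    ∑[ i ≤ n ]
    (let k = toℕ i in
    (binom (2 ℕ.* n) (+ n ℤ.- + k) × 1# - binom (2 ℕ.* n) (+ n ℤ.- + k ℤ.- + 1) × 1#)
    * t ^ k * q ^ (k ℕ.* (k ℕ.+ 1)) * T k t⁻¹ q⁻¹)
theorem1p1 R t q t⁻¹ q⁻¹ r tt⁻¹≈1 qq⁻¹≈1 _ n = begin
  E t q r n
    -- The denominators of the two q-integers combine to `r ^ 2` per down step; the index shifts
    -- because the fraction starts at m = 1.
    ≈⟨ convergent-paths (λ m → qInt q r m * tqInt t q r m) (λ i → r ^ 2 * Λ (suc i)) 1
         (λ i → solve 3 (λ x y r → x :* r :* (y :* r) := r :* (r :* :1) :* (x :* y))
                  refl (1# - q ^ suc i) (1# - t * q ^ suc i) r)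
         n n ℕ.≤-refl ⟩
  paths (λ i → r ^ 2 * Λ (suc i)) 1 n
    -- Paths ending at height 0 have index 1, whence L = 1 + 2n - 1 = 2n.
    ≈⟨ paths-ballot (r ^ 2) n 1 (2 ℕ.* n)
         (≡.cong (λ m → suc (n ℕ.+ m)) (ℕ.+-identityʳ n)) ⟩
  (r ^ 2) ^ n * (A⁺ 1 ⊛ ballot (2 ℕ.* n)) n
    ≈⟨ *-cong (^-assocʳ r 2 n) (sum-cong-≋ {suc n} λ i → term (toℕ i) (toℕ≤pred[n] i)) ⟩
  _ ∎
  where
  open Over R
  open IntegerSolver R
  open ContinuedFraction R
  open Ballot R
  open Euler R t q
  open Reversed R t q t⁻¹ q⁻¹
  open SemiringExp semiring using (^-assocʳ)
  open SemiringSum semiring using (sum-cong-≋)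
  open SetoidReasoning setoid

  term : ∀ k → k ℕ.≤ n →
    A 1 (suc k) * ballot (2 ℕ.* n) (n ∸ k) ≈
    (binom (2 ℕ.* n) (+ n ℤ.- + k) × 1# - binom (2 ℕ.* n) (+ n ℤ.- + k ℤ.- + 1) × 1#)
      * t ^ k * q ^ (k ℕ.* (k ℕ.+ 1)) * T k t⁻¹ q⁻¹
  -- As k ≤ n, the integer n - k is the natural number `n ∸ k`, and the difference of binomials
  -- becomes `ballot`.
  term k k≤n rewrite ≡.trans (ℤ.m-n≡m⊖n n k) (ℤ.⊖-≥ k≤n) = trans
    (*-congʳ (A₁≈P tt⁻¹≈1 qq⁻¹≈1 k))
    (solve 4 (λ x y z b → x :* y :* z :* b := b :* x :* y :* z) refl
      (t ^ k) (q ^ (k ℕ.* (k ℕ.+ 1))) (T k t⁻¹ q⁻¹) (ballot (2 ℕ.* n) (n ∸ k)))
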